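{- Let $P$ be a path on $n$ vertices and let $I, J$ be two $k$-path vertex covers of $P$. Then $I$ and $J$ are reconfigurable under $\mathsf{TS}$ if and only if $|I| = |J|$. Moreover, a shortest $\mathsf{TS}$-sequence between $I$ and $J$ (when one exists) can be computed in $O(n^2)$ time.
   Context: Fix an integer $k \geq 2$. A $k$-path is a path on $k$ vertices. A vertex subset $I \subseteq V(G)$ is a $k$-path vertex cover of $G$ if every $k$-path in $G$ contains at least one vertex of $I$. A sequence $\langle I_0, \dots, I_\ell \rangle$ of $k$-path vertex covers of $G$ has length $\ell$; it is a $\mathsf{TS}$-sequence between $I_0$ and $I_\ell$ if for each $i<\ell$ there are vertices $x_i,y_i$ with $I_i \setminus I_{i+1} = \{x_i\}$, $I_{i+1}\setminus I_i = \{y_i\}$ and $x_iy_i \in E(G)$. $I$ and $J$ are reconfigurable under $\mathsf{TS}$ if a $\mathsf{TS}$-sequence between them exists; a shortest one is one of minimum length. -}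

module Defs where

open import Data.Bool using (if_then_else_)
open import Data.Fin using (Fin; toℕ; fromℕ; inject₁; zero; suc)
open import Data.Fin.Subset using (Subset; _∈_; _─_; ⁅_⁆)
open import Data.List using (List; []; _∷_; map)
open import Data.Nat using (ℕ; zero; suc; _+_; _*_; _∸_; _≤_; _≡ᵇ_)
open import Data.Nat.Properties using (1+n≢n)
open import Data.Product using (∃; ∃-syntax; _×_)
open import Data.Sum using (_⊎_; inj₁; inj₂; swap)
open import Data.Vec using (Vec; toList; _++_)
open import Data.Vec.Relation.Unary.Any using (Any)
open import Data.Vec.Relation.Unary.Linked using (Linked)
open import Data.Vec.Relation.Unary.Unique.Propositional using (Unique)
open import Level using (0ℓ)
open import Relation.Binary using (Rel; Symmetric; Irreflexive)
open import Relation.Binary.PropositionalEquality using (_≡_; _≢_; refl; sym)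

record Graph (n : ℕ) : Set₁ where
  field
    Adj    : Rel (Fin n) 0ℓ
    symm   : Symmetric Adj
    irrefl : Irreflexive _≡_ Adj

open Graph public using (Adj)

path : (n : ℕ) → Graph n
path n = record
  { Adj    = λ x y → toℕ y ≡ suc (toℕ x) ⊎ toℕ x ≡ suc (toℕ y)
  ; symm   = swap
  ; irrefl = λ { refl (inj₁ e) → 1+n≢n (sym e) ; refl (inj₂ e) → 1+n≢n (sym e) }
  }

IsPath : ∀ {n m} → Graph n → Vec (Fin n) m → Set
IsPath G vs = Linked (Adj G) vs × Unique vs

IsPathVertexCover : ∀ {n} → Graph n → ℕ → Subset n → Set
IsPathVertexCover {n} G k I = (vs : Vec (Fin n) k) → IsPath G vs → Any (_∈ I) vs

record TSSequence {n} (G : Graph n) (k : ℕ) (I J : Subset n) (ℓ : ℕ) : Set where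
  field
    sets   : Fin (suc ℓ) → Subset n
    covers : ∀ i → IsPathVertexCover G k (sets i)
    start  : sets zero ≡ I
    end    : sets (fromℕ ℓ) ≡ J
    from   : Fin ℓ → Fin n
    to     : Fin ℓ → Fin n
    leaves : ∀ i → sets (inject₁ i) ─ sets (suc i) ≡ ⁅ from i ⁆
    enters : ∀ i → sets (suc i) ─ sets (inject₁ i) ≡ ⁅ to i ⁆
    slides : ∀ i → Adj G (from i) (to i)

Reconfigurable : ∀ {n} → Graph n → ℕ → Subset n → Subset n → Set
Reconfigurable G k I J = ∃[ ℓ ] TSSequence G k I J ℓ

IsShortest : ∀ {n} {G : Graph n} {k I J ℓ} → TSSequence G k I J ℓ → Set
IsShortest {G = G} {k} {I} {J} {ℓ} _ = ∀ {ℓ′} → TSSequence G k I J ℓ′ → ℓ ≤ ℓ′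

infix 4 _∈O_

_∈O_ : (ℕ → ℕ) → (ℕ → ℕ) → Set
f ∈O g = ∃[ c ] ∃[ n₀ ] (∀ n → n₀ ≤ n → f n ≤ c * g n)

-- The machine model is a random access machine under the uniform cost
-- criterion, with structured control flow: registers and memory cells hold
-- natural numbers, and every assignment, store and test takes one step.
-- Addition and truncated subtraction are the only arithmetic.

Reg : Set
Reg = ℕ

record State : Set where
  field
    reg : Reg → ℕ
    mem : ℕ → ℕ

open State public

data Operation : Set where
  const   : ℕ → Operation
  copy    : Reg → Operation
  add sub : Reg → Reg → Operation
  load    : Reg → Operation

infix  6 _≔_
infixr 5 _⨾_

data Program : Set where
  _≔_   : Reg → Operation → Program
  store : (address value : Reg) → Program
  _⨾_   : Program → Program → Program
  ifz   : Reg → (zero-branch nonzero-branch : Program) → Program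
  while : Reg → Program → Program

eval : Operation → State → ℕ
eval (const c) s = c
eval (copy x)  s = reg s x
eval (add x y) s = reg s x + reg s y
eval (sub x y) s = reg s x ∸ reg s y
eval (load x)  s = mem s (reg s x)

_[_↦_] : (ℕ → ℕ) → ℕ → ℕ → ℕ → ℕ
(f [ a ↦ v ]) b = if a ≡ᵇ b then v else f b

-- Exec p s s′ t: started in state s, p halts in state s′ after t steps.
data Exec : Program → State → State → ℕ → Set where
  assign     : ∀ {x e s} →
               Exec (x ≔ e) s (record s { reg = reg s [ x ↦ eval e s ] }) 1
  store      : ∀ {x y s} →
               Exec (store x y) s (record s { mem = mem s [ reg s x ↦ reg s y ] }) 1
  seq        : ∀ {p q s s′ s″ t u} →
               Exec p s s′ t → Exec q s′ s″ u → Exec (p ⨾ q) s s″ (t + u)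
  if-zero    : ∀ {x p q s s′ t} → reg s x ≡ 0 →
               Exec p s s′ t → Exec (ifz x p q) s s′ (suc t)
  if-nonzero : ∀ {x p q s s′ t} → reg s x ≢ 0 →
               Exec q s s′ t → Exec (ifz x p q) s s′ (suc t)
  while-stop : ∀ {x p s} → reg s x ≡ 0 → Exec (while x p) s s 1
  while-step : ∀ {x p s s′ s″ t u} → reg s x ≢ 0 →
               Exec p s s′ t → Exec (while x p) s′ s″ u →
               Exec (while x p) s s″ (suc (t + u))

contents : List ℕ → ℕ → ℕ
contents []       _       = 0
contents (v ∷ vs) zero    = v
contents (v ∷ vs) (suc a) = contents vs a

-- Register 0 holds n, cells 0 … n-1 the indicator vector of I and cells
-- n … 2n-1 that of J; everything else is 0.
input : ∀ {n} → Subset n → Subset n → State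
input {n} I J = record
  { reg = contents (n ∷ [])
  ; mem = contents (map (λ b → if b then 1 else 0) (toList (I ++ J)))
  }

-- A TS-sequence is output as its list of slides: register 0 holds its length,
-- and from the address in register 1 on stand x₀, y₀, x₁, y₁, ….  Together
-- with I this determines the sequence; writing out all of its sets would take
-- cubic time on some inputs, as shortest sequences can have quadratic length.
record Outputs {n} {G : Graph n} {k I J ℓ} (S : TSSequence G k I J ℓ) (s : State) : Set where
  open TSSequence S
  field
    out-length : reg s 0 ≡ ℓ
    out-from   : ∀ i → mem s (reg s 1 + 2 * toℕ i) ≡ toℕ (from i)
    out-to     : ∀ i → mem s (suc (reg s 1 + 2 * toℕ i)) ≡ toℕ (to i)

ComputesShortestTS : (G : ∀ n → Graph n) (k : ℕ) → Program → (T : ℕ → ℕ) → Set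
ComputesShortestTS G k p T =
  ∀ n (I J : Subset n) →
  IsPathVertexCover (G n) k I → IsPathVertexCover (G n) k J →
  Reconfigurable (G n) k I J →
  ∃[ s ] ∃[ t ] ∃[ ℓ ] ∃ λ (S : TSSequence (G n) k I J ℓ) →
    Exec p (input I J) s t × t ≤ T n × IsShortest S × Outputs S s

module Submission where

open import Defs
open import Data.Bool as Bool using (true; false; if_then_else_)
open import Data.Fin using (Fin; zero; suc; toℕ; fromℕ; fromℕ<; inject₁)
open import Data.Fin.Properties using (toℕ<n; toℕ-injective; toℕ-fromℕ<; toℕ-inject₁)
open import Data.Fin.Subset using (Subset; ∣_∣; _─_; ⁅_⁆; _∈_; inside; outside; ⊥)
open import Data.List as List using (List; []; _∷_; _∷ʳ_; length)
open import Data.List.Properties using (length-++)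
open import Data.Nat using (ℕ; zero; suc; _+_; _*_; _∸_; _^_; _≤_; _<_; _≡ᵇ_; z≤n; s≤s; s≤s⁻¹; _⊔_; _⊓_; ∣_-_∣)
open import Data.Nat.Properties
open import Data.Nat.Solver using (module +-*-Solver)
open import Data.Product using (_×_; _,_; proj₁; proj₂; ∃; ∃-syntax)
open import Data.Sum using (_⊎_; inj₁; inj₂)
open import Data.Unit using (⊤)
open import Data.Vec using (Vec; []; _∷_; lookup; _++_; toList)
open import Data.Vec.Properties using (lookup⇒[]=; []=⇒lookup; ∷-injectiveʳ)
open import Data.Vec.Relation.Unary.All as All using (All; []; _∷_)
open import Data.Vec.Relation.Unary.AllPairs using ([]; _∷_)
open import Data.Vec.Relation.Unary.Any using (Any; here; there)
open import Data.Vec.Relation.Unary.Linked using ([]; [-]; _∷_)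
open import Function using (_∘_)
open import Function.Bundles using (_⇔_; mk⇔)
open import Relation.Nullary using (yes; no; contradiction)
open import Relation.Binary.PropositionalEquality using (_≡_; _≢_; refl; sym; trans; cong; cong₂; subst; subst₂; module ≡-Reasoning)

-- Describe a set S by its profile p ↦ holes S p, the number of non-members below p.
-- Being the profile of a k-path vertex cover is a system of difference constraints, hence stable under
-- pointwise maximum and minimum, and since k ≥ 2 it is also stable under cutting
-- off at a bound with one unit step. Sliding a token changes the profile by one
-- at one point, so the ℓ¹-distance of profiles bounds the length from below.
-- Both I and J are joined to the maximum of their profiles by lowering the bound
-- one point at a time, for d = n, …, 1 and left to right within each d; every
-- change lengthens the slide sequence by one move at one of its ends, and the
-- ℓ¹-distance between its ends by one. The order of the moves is fixed in
-- advance, so a double loop over d and the position computes the sequence.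

private
  variable
    n k p : ℕ
    S T : Subset n
    x y v : Fin n

-- Profiles of vertex sets

hole : Bool.Bool → ℕ
hole inside  = 0
hole outside = 1

holes : Subset n → ℕ → ℕ
holes []      p       = 0
holes (_ ∷ _) zero    = 0
holes (b ∷ S) (suc p) = hole b + holes S p

holes-zero : (S : Subset n) → holes S 0 ≡ 0
holes-zero []      = refl
holes-zero (_ ∷ _) = refl

-- `holes` recurses from the first vertex on, while later arguments move the upper end of the
-- counted range; this identity trades one for the other.
holes-suc : (S : Subset n) (v : Fin n) →
            holes S (suc (toℕ v)) ≡ hole (lookup S v) + holes S (toℕ v)
holes-suc (b ∷ S) zero    = cong (hole b +_) (holes-zero S)
holes-suc (b ∷ S) (suc v) = begin
  hole b + holes S (suc (toℕ v))                     ≡⟨ cong (hole b +_) (holes-suc S v) ⟩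
  hole b + (hole (lookup S v) + holes S (toℕ v))     ≡⟨ +-assoc (hole b) _ _ ⟨
  hole b + hole (lookup S v) + holes S (toℕ v)       ≡⟨ cong (_+ holes S (toℕ v)) (+-comm (hole b) _) ⟩
  hole (lookup S v) + hole b + holes S (toℕ v)       ≡⟨ +-assoc (hole (lookup S v)) _ _ ⟩
  hole (lookup S v) + (hole b + holes S (toℕ v))     ∎
  where open ≡-Reasoning

holes-mono : (S : Subset n) → ∀ p → holes S p ≤ holes S (suc p)
holes-mono []      p       = z≤n
holes-mono (b ∷ S) zero    = z≤n
holes-mono (b ∷ S) (suc p) = +-monoʳ-≤ (hole b) (holes-mono S p)

holes-step : (S : Subset n) → ∀ p → holes S (suc p) ≤ suc (holes S p)
holes-step []            p       = z≤n
holes-step (inside  ∷ S) zero    = ≤-trans (≤-reflexive (holes-zero S)) z≤n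
holes-step (outside ∷ S) zero    = s≤s (≤-reflexive (holes-zero S))
holes-step (inside  ∷ S) (suc p) = holes-step S p
holes-step (outside ∷ S) (suc p) = s≤s (holes-step S p)

holes-≤ : (S : Subset n) → ∀ p → holes S p ≤ n
holes-≤ []            p       = z≤n
holes-≤ (_ ∷ _)       zero    = z≤n
holes-≤ (inside  ∷ S) (suc p) = m≤n⇒m≤1+n (holes-≤ S p)
holes-≤ (outside ∷ S) (suc p) = s≤s (holes-≤ S p)

∣S∣+holes≡n : (S : Subset n) → ∣ S ∣ + holes S n ≡ n
∣S∣+holes≡n []            = refl
∣S∣+holes≡n (inside  ∷ S) = cong suc (∣S∣+holes≡n S)
∣S∣+holes≡n (outside ∷ S) = trans (+-suc ∣ S ∣ _) (cong suc (∣S∣+holes≡n S))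

holes-injective : (S T : Subset n) → (∀ p → p ≤ n → holes S p ≡ holes T p) → S ≡ T
holes-injective []            []            h = refl
holes-injective (inside  ∷ S) (inside  ∷ T) h =
  cong (inside ∷_) (holes-injective S T λ p p≤n → h (suc p) (s≤s p≤n))
holes-injective (outside ∷ S) (outside ∷ T) h =
  cong (outside ∷_) (holes-injective S T λ p p≤n → suc-injective (h (suc p) (s≤s p≤n)))
holes-injective (inside  ∷ S) (outside ∷ T) h =
  contradiction (trans (sym (holes-zero S)) (h 1 (s≤s z≤n))) 0≢1+n
holes-injective (outside ∷ S) (inside  ∷ T) h =
  contradiction (trans (sym (holes-zero T)) (sym (h 1 (s≤s z≤n)))) 0≢1+n

-- Inverse to `holes` on sequences that start at 0 and rise by at most one per step.
fill : ∀ n → (ℕ → ℕ) → Subset n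
fill zero    z = []
fill (suc n) z = (z 1 ≡ᵇ z 0) ∷ fill n (z ∘ suc)

hole-≡ᵇ : ∀ a b → a ≤ b → b ≤ suc a → hole (b ≡ᵇ a) + a ≡ b
hole-≡ᵇ zero    zero          a≤b       b≤1+a     = refl
hole-≡ᵇ zero    (suc zero)    a≤b       b≤1+a     = refl
hole-≡ᵇ zero    (suc (suc b)) a≤b       (s≤s ())
hole-≡ᵇ (suc a) (suc b)       (s≤s a≤b) (s≤s b≤a) =
  trans (+-suc (hole (b ≡ᵇ a)) a) (cong suc (hole-≡ᵇ a b a≤b b≤a))

-- The summand `z 0` lets the induction pass to `z ∘ suc`, which in general does not start at 0.
holes-fill : ∀ n (z : ℕ → ℕ) → (∀ p → z p ≤ z (suc p)) → (∀ p → z (suc p) ≤ suc (z p)) →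
             ∀ p → p ≤ n → holes (fill n z) p + z 0 ≡ z p
holes-fill n       z mono step zero    p≤n       = cong (_+ z 0) (holes-zero (fill n z))
holes-fill (suc n) z mono step (suc p) (s≤s p≤n) = begin
  h + r + z 0     ≡⟨ cong (_+ z 0) (+-comm h r) ⟩
  r + h + z 0     ≡⟨ +-assoc r h (z 0) ⟩
  r + (h + z 0)   ≡⟨ cong (r +_) (hole-≡ᵇ (z 0) (z 1) (mono 0) (step 0)) ⟩
  r + z 1         ≡⟨ holes-fill n (z ∘ suc) (mono ∘ suc) (step ∘ suc) p p≤n ⟩
  z (suc p)       ∎
  where
  open ≡-Reasoning
  h = hole (z 1 ≡ᵇ z 0)
  r = holes (fill n (z ∘ suc)) p

-- Covers of a path

-- p ↗ vs and p ↘ vs: the path vs runs through p, p + 1, … and p - 1, p - 2, … respectively.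
data _↗_ {n} : ℕ → Vec (Fin n) k → Set where
  []  : p ↗ []
  _∷_ : ∀ {vs : Vec (Fin n) k} → toℕ v ≡ p → suc (toℕ v) ↗ vs → p ↗ (v ∷ vs)

data _↘_ {n} : ℕ → Vec (Fin n) k → Set where
  []  : p ↘ []
  _∷_ : ∀ {vs : Vec (Fin n) k} → suc (toℕ v) ≡ p → toℕ v ↘ vs → p ↘ (v ∷ vs)

↗-bound : {vs : Vec (Fin n) k} → p ↗ vs → p ≤ n → p + k ≤ n
↗-bound {p = p} []                       p≤n = ≤-trans (≤-reflexive (+-identityʳ p)) p≤n
↗-bound         (_∷_ {v = v} refl r) p≤n = ≤-trans (≤-reflexive (+-suc _ _)) (↗-bound r (toℕ<n v))

↘-bound : {vs : Vec (Fin n) k} → p ↘ vs → k ≤ p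
↘-bound []         = z≤n
↘-bound (refl ∷ r) = s≤s (↘-bound r)

window : p + k ≤ n → ∃ λ (vs : Vec (Fin n) k) → p ↗ vs
window {p} {zero}      p+k≤n = [] , []
window {p} {suc k} {n} p+k≤n = fromℕ< _ ∷ proj₁ rest , first≡p ∷ proj₂ rest
  where
  p+k<n : suc p + k ≤ n
  p+k<n = ≤-trans (≤-reflexive (sym (+-suc p k))) p+k≤n
  first≡p : toℕ (fromℕ< (≤-trans (s≤s (m≤m+n p k)) p+k<n)) ≡ p
  first≡p = toℕ-fromℕ< _
  rest = window {suc (toℕ (fromℕ< (≤-trans (s≤s (m≤m+n p k)) p+k<n)))} {k}
                (subst (λ q → suc q + k ≤ n) (sym first≡p) p+k<n)

↗-above : {vs : Vec (Fin n) k} → p ↗ vs → All (λ w → p ≤ toℕ w) vs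
↗-above []         = []
↗-above (refl ∷ r) = ≤-refl ∷ All.map <⇒≤ (↗-above r)

↗-isPath : {vs : Vec (Fin n) k} → p ↗ vs → IsPath (path n) vs
↗-isPath []         = [] , []
↗-isPath (_ ∷ [])   = [-] , [] ∷ []
↗-isPath (_∷_ {v = v} _ r@(e ∷ _)) with ↗-isPath r
... | linked , unique =
  inj₁ e ∷ linked , All.map (λ v<u v≡u → <⇒≢ v<u (cong toℕ v≡u)) (↗-above r) ∷ unique

-- A path in a path graph cannot turn: the vertex after a turn would be the one before it, against
-- uniqueness.
isPath-monotone : {vs : Vec (Fin n) k} → IsPath (path n) (v ∷ vs) →
                  (toℕ v ↗ (v ∷ vs)) ⊎ (suc (toℕ v) ↘ (v ∷ vs))
isPath-monotone {vs = []}    _ = inj₁ (refl ∷ [])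
isPath-monotone {vs = w ∷ _} (v~w ∷ linked , v∉ws ∷ unique)
  with v~w | isPath-monotone (linked , unique) | v∉ws
... | inj₁ e | inj₁ (_ ∷ up)     | _           = inj₁ (refl ∷ e ∷ up)
... | inj₂ e | inj₂ (_ ∷ down)   | _           = inj₂ (refl ∷ sym e ∷ down)
-- A single vertex counts as either direction, so here the first edge decides.
... | inj₁ e | inj₂ (_ ∷ [])     | _           = inj₁ (refl ∷ e ∷ [])
... | inj₂ e | inj₁ (_ ∷ [])     | _           = inj₂ (refl ∷ sym e ∷ [])
... | inj₁ e | inj₂ (_ ∷ e′ ∷ _) | _ ∷ v≢u ∷ _ =
  contradiction (toℕ-injective (suc-injective (trans (sym e) (sym e′)))) v≢u
... | inj₂ e | inj₁ (_ ∷ e′ ∷ _) | _ ∷ v≢u ∷ _ =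
  contradiction (toℕ-injective (trans e (sym e′))) v≢u

-- For a profile: the `k` vertices from `p` on are not all holes. Having `k` on the right avoids
-- subtraction and shows a difference constraint.
Gap : ℕ → ℕ → (ℕ → ℕ) → Set
Gap n k z = ∀ p → p + k ≤ n → z (p + k) < k + z p

holes-∈ : v ∈ S → holes S (suc (toℕ v)) ≡ holes S (toℕ v)
holes-∈ {v = v} {S = S} v∈S =
  trans (holes-suc S v) (cong (λ b → hole b + holes S (toℕ v)) ([]=⇒lookup v∈S))

member-or-hole : (S : Subset n) (v : Fin n) → v ∈ S ⊎ holes S (suc (toℕ v)) ≡ suc (holes S (toℕ v))
member-or-hole S v with lookup S v in eq
... | inside  = inj₁ (lookup⇒[]= v S eq)
... | outside = inj₂ (trans (holes-suc S v) (cong (λ b → hole b + holes S (toℕ v)) eq))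

-- Either the first vertex is a member, or it is a hole, and dropping it lowers both the hole count
-- and the length of the window by one. The strict inequality fails for the empty window.
↗-hit : {vs : Vec (Fin n) k} (S : Subset n) → p ↗ vs → holes S (p + k) < k + holes S p → Any (_∈ S) vs
↗-hit {p = p} S [] few =
  contradiction (subst (λ q → holes S q < holes S p) (+-identityʳ p) few) (<-irrefl refl)
↗-hit {k = suc k} S (_∷_ {v = v} refl r) few with member-or-hole S v
... | inj₁ v∈S = here v∈S
... | inj₂ e   = there (↗-hit S r (begin-strict
  holes S (suc (toℕ v) + k)       ≡⟨ cong (holes S) (+-suc (toℕ v) k) ⟨
  holes S (toℕ v + suc k)         <⟨ few ⟩
  suc k + holes S (toℕ v)         ≡⟨ +-suc k _ ⟨
  k + suc (holes S (toℕ v))       ≡⟨ cong (k +_) e ⟨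
  k + holes S (suc (toℕ v))       ∎))
  where open ≤-Reasoning

↘-hit : {vs : Vec (Fin n) k} (S : Subset n) → p ↘ vs → holes S p < k + holes S (p ∸ k) → Any (_∈ S) vs
↘-hit {p = p} S []                   few = contradiction few (<-irrefl refl)
↘-hit         S (_∷_ {v = v} refl r) few with member-or-hole S v
... | inj₁ v∈S = here v∈S
... | inj₂ e   = there (↘-hit S r (s≤s⁻¹ (≤-trans (≤-reflexive (cong suc (sym e))) few)))

gap⇒cover : (S : Subset n) → Gap n (suc k) (holes S) → IsPathVertexCover (path n) (suc k) S
gap⇒cover {n} {k} S gap (v ∷ vs) isPath with isPath-monotone isPath
... | inj₁ up   = ↗-hit S up (gap (toℕ v) (↗-bound up (<⇒≤ (toℕ<n v))))
-- A descending path from `v` occupies the window that starts at `v ∸ k`; since it fits above 0,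
-- this subtraction is not truncated.
... | inj₂ down = ↘-hit S down (subst (λ q → holes S q < suc k + holes S (toℕ v ∸ k)) e
                   (gap (toℕ v ∸ k) (≤-trans (≤-reflexive e) (toℕ<n v))))
  where
  e : toℕ v ∸ k + suc k ≡ suc (toℕ v)
  e = m∸n+n≡m (↘-bound down)

holes-≤+ : (S : Subset n) → ∀ p k → holes S (p + k) ≤ k + holes S p
holes-≤+ S p zero    = ≤-reflexive (cong (holes S) (+-identityʳ p))
holes-≤+ S p (suc k) = begin
  holes S (p + suc k)     ≡⟨ cong (holes S) (+-suc p k) ⟩
  holes S (suc (p + k))   ≤⟨ holes-step S (p + k) ⟩
  suc (holes S (p + k))   ≤⟨ s≤s (holes-≤+ S p k) ⟩
  suc k + holes S p       ∎
  where open ≤-Reasoning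

-- A member contributes no hole, and each of the other vertices at most one.
hit-↗ : {vs : Vec (Fin n) k} (S : Subset n) → p ↗ vs → Any (_∈ S) vs → holes S (p + k) < k + holes S p
hit-↗ {k = suc k} S (_∷_ {v = v} refl r) (here v∈S) = s≤s (begin
  holes S (toℕ v + suc k)       ≡⟨ cong (holes S) (+-suc (toℕ v) k) ⟩
  holes S (suc (toℕ v) + k)     ≤⟨ holes-≤+ S (suc (toℕ v)) k ⟩
  k + holes S (suc (toℕ v))     ≡⟨ cong (k +_) (holes-∈ v∈S) ⟩
  k + holes S (toℕ v)           ∎)
  where open ≤-Reasoning
hit-↗ {k = suc k} S (_∷_ {v = v} refl r) (there any) = begin-strict
  holes S (toℕ v + suc k)       ≡⟨ cong (holes S) (+-suc (toℕ v) k) ⟩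
  holes S (suc (toℕ v) + k)     <⟨ hit-↗ S r any ⟩
  k + holes S (suc (toℕ v))     ≤⟨ +-monoʳ-≤ k (holes-step S (toℕ v)) ⟩
  k + suc (holes S (toℕ v))     ≡⟨ +-suc k _ ⟩
  suc k + holes S (toℕ v)       ∎
  where open ≤-Reasoning

cover⇒gap : (S : Subset n) → IsPathVertexCover (path n) k S → Gap n k (holes S)
cover⇒gap S cover p p+k≤n with window p+k≤n
... | vs , up = hit-↗ S up (cover vs (↗-isPath up))

-- Slides and distances

-- Shift S T x y: a token of S slides from x to y = x + 1, which gives T.
data Shift : ∀ {n} → Subset n → Subset n → Fin n → Fin n → Set where
  here  : Shift (inside ∷ outside ∷ S) (outside ∷ inside ∷ S) zero (suc zero)
  there : ∀ {b} → Shift S T x y → Shift (b ∷ S) (b ∷ T) (suc x) (suc y)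

Slide : Subset n → Subset n → Fin n → Fin n → Set
Slide {n} S T x y = S ─ T ≡ ⁅ x ⁆ × T ─ S ≡ ⁅ y ⁆ × Adj (path n) x y

p─p≡⊥ : (S : Subset n) → S ─ S ≡ ⊥
p─p≡⊥ []            = refl
p─p≡⊥ (inside  ∷ S) = cong (outside ∷_) (p─p≡⊥ S)
p─p≡⊥ (outside ∷ S) = cong (outside ∷_) (p─p≡⊥ S)

─-antisym : (S T : Subset n) → S ─ T ≡ ⊥ → T ─ S ≡ ⊥ → S ≡ T
─-antisym []            []            _ _ = refl
─-antisym (inside  ∷ S) (inside  ∷ T) e f = cong (inside ∷_) (─-antisym S T (∷-injectiveʳ e) (∷-injectiveʳ f))
─-antisym (outside ∷ S) (outside ∷ T) e f = cong (outside ∷_) (─-antisym S T (∷-injectiveʳ e) (∷-injectiveʳ f))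
─-antisym (inside  ∷ S) (outside ∷ T) () f
─-antisym (outside ∷ S) (inside  ∷ T) e ()

Shift⇒next : Shift S T x y → toℕ y ≡ suc (toℕ x)
Shift⇒next here      = refl
Shift⇒next (there s) = cong suc (Shift⇒next s)

Shift⇒leaves : Shift S T x y → S ─ T ≡ ⁅ x ⁆
Shift⇒leaves (here {S = S})        = cong (λ R → inside ∷ outside ∷ R) (p─p≡⊥ S)
Shift⇒leaves (there {b = inside}  s) = cong (outside ∷_) (Shift⇒leaves s)
Shift⇒leaves (there {b = outside} s) = cong (outside ∷_) (Shift⇒leaves s)

Shift⇒enters : Shift S T x y → T ─ S ≡ ⁅ y ⁆
Shift⇒enters (here {S = S})        = cong (λ R → outside ∷ inside ∷ R) (p─p≡⊥ S)
Shift⇒enters (there {b = inside}  s) = cong (outside ∷_) (Shift⇒enters s)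
Shift⇒enters (there {b = outside} s) = cong (outside ∷_) (Shift⇒enters s)

Shift⇒slide : Shift S T x y → Slide S T x y
Shift⇒slide s = Shift⇒leaves s , Shift⇒enters s , inj₁ (Shift⇒next s)

Shift⇒slide⁻¹ : Shift S T x y → Slide T S y x
Shift⇒slide⁻¹ s = Shift⇒enters s , Shift⇒leaves s , inj₂ (Shift⇒next s)

-- Outside the two positions both differences are empty, so the sets agree there; at the positions
-- the differences fix all memberships.
slide⇒Shift : (S T : Subset n) (x y : Fin n) → toℕ y ≡ suc (toℕ x) →
              S ─ T ≡ ⁅ x ⁆ → T ─ S ≡ ⁅ y ⁆ → Shift S T x y
slide⇒Shift (inside ∷ outside ∷ S) (outside ∷ inside ∷ T) zero (suc zero) _ l e
  with refl ← ─-antisym S T (∷-injectiveʳ (∷-injectiveʳ l)) (∷-injectiveʳ (∷-injectiveʳ e)) = here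
slide⇒Shift (inside  ∷ S)           (inside  ∷ T)           (suc x) (suc y)    n l e =
  there (slide⇒Shift S T x y (suc-injective n) (∷-injectiveʳ l) (∷-injectiveʳ e))
slide⇒Shift (outside ∷ S)           (outside ∷ T)           (suc x) (suc y)    n l e =
  there (slide⇒Shift S T x y (suc-injective n) (∷-injectiveʳ l) (∷-injectiveʳ e))
slide⇒Shift (inside  ∷ S)           (outside ∷ T)           (suc x) (suc y)    n () e
slide⇒Shift (outside ∷ S)           (inside  ∷ T)           (suc x) (suc y)    n l ()
slide⇒Shift (_ ∷ _ ∷ S)             (inside  ∷ _ ∷ T)       zero    (suc zero) n () e
slide⇒Shift (outside ∷ _ ∷ S)       (outside ∷ _ ∷ T)       zero    (suc zero) n () e
slide⇒Shift (inside ∷ inside ∷ S)   (outside ∷ outside ∷ T) zero    (suc zero) n () e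
slide⇒Shift (inside ∷ inside ∷ S)   (outside ∷ inside ∷ T)  zero    (suc zero) n l ()
slide⇒Shift (inside ∷ outside ∷ S)  (outside ∷ outside ∷ T) zero    (suc zero) n l ()

-- A count below `p` includes both of `x` and `y` or neither, unless `p` separates them, which
-- happens only at `y`.
Shift⇒holes-≢ : Shift S T x y → ∀ p → p ≢ toℕ y → holes S p ≡ holes T p
Shift⇒holes-≢ here                zero          p≢y = refl
Shift⇒holes-≢ here                (suc zero)    p≢y = contradiction refl p≢y
Shift⇒holes-≢ here                (suc (suc p)) p≢y = refl
Shift⇒holes-≢ (there s)           zero          p≢y = refl
Shift⇒holes-≢ (there {b = b} s)   (suc p)       p≢y = cong (hole b +_) (Shift⇒holes-≢ s p (p≢y ∘ cong suc))

Shift⇒holes-y : Shift S T x y → holes T (toℕ y) ≡ suc (holes S (toℕ y))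
Shift⇒holes-y here              = refl
Shift⇒holes-y (there {b = b} s) = trans (cong (hole b +_) (Shift⇒holes-y s)) (+-suc (hole b) _)

-- Only the increments of the profiles at `x` and at `y` differ: the first forces a token of `S`
-- onto `x`, the second a token of `T` onto `y`.
holes⇒Shift : (S T : Subset n) (x y : Fin n) → toℕ y ≡ suc (toℕ x) →
              (∀ p → p ≤ n → p ≢ toℕ y → holes S p ≡ holes T p) →
              holes T (toℕ y) ≡ suc (holes S (toℕ y)) → Shift S T x y
holes⇒Shift (b ∷ S) (c ∷ T) (suc x) (suc y) next off at = go b c refl refl
  where
  first : hole b ≡ hole c
  first = trans (sym (trans (cong (hole b +_) (holes-zero S)) (+-identityʳ _)))
         (trans (off 1 (s≤s z≤n) (λ e → contradiction (trans (suc-injective e) (suc-injective next)) 0≢1+n))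
                (trans (cong (hole c +_) (holes-zero T)) (+-identityʳ _)))
  rest : b ≡ c → Shift S T x y
  rest refl = holes⇒Shift S T x y (suc-injective next)
    (λ p p≤n p≢y → +-cancelˡ-≡ (hole b) _ _ (off (suc p) (s≤s p≤n) (p≢y ∘ suc-injective)))
    (+-cancelˡ-≡ (hole b) _ _ (trans at (sym (+-suc (hole b) _))))
  go : ∀ b′ c′ → b ≡ b′ → c ≡ c′ → Shift (b ∷ S) (c ∷ T) (suc x) (suc y)
  go inside  inside  refl refl = there (rest refl)
  go outside outside refl refl = there (rest refl)
  go inside  outside refl refl = contradiction first 0≢1+n
  go outside inside  refl refl = contradiction (sym first) 0≢1+n
holes⇒Shift (inside ∷ outside ∷ S) (outside ∷ inside ∷ T) zero (suc zero) next off at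
  with refl ← holes-injective S T (λ p p≤n → suc-injective (off (suc (suc p)) (s≤s (s≤s p≤n)) λ ())) = here
holes⇒Shift (inside  ∷ b ∷ S) (inside  ∷ c ∷ T) zero (suc zero) next off ()
holes⇒Shift (outside ∷ b ∷ S) (inside  ∷ c ∷ T) zero (suc zero) next off ()
holes⇒Shift (outside ∷ b ∷ S) (outside ∷ c ∷ T) zero (suc zero) next off ()
holes⇒Shift (inside  ∷ inside ∷ S) (outside ∷ c ∷ T) zero (suc zero) next off at =
  contradiction (trans (sym (holes-zero S)) (trans (off 2 (s≤s (s≤s z≤n)) λ ()) refl)) 0≢1+n
holes⇒Shift (inside  ∷ outside ∷ S) (outside ∷ outside ∷ T) zero (suc zero) next off at =
  contradiction (suc-injective (trans (sym (cong suc (holes-zero S))) (off 2 (s≤s (s≤s z≤n)) λ ()))) 0≢1+n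

sum : (ℕ → ℕ) → ℕ → ℕ
sum f zero    = 0
sum f (suc n) = f n + sum f n

sum-cong : (f g : ℕ → ℕ) → ∀ n → (∀ p → p < n → f p ≡ g p) → sum f n ≡ sum g n
sum-cong f g zero    eq = refl
sum-cong f g (suc n) eq = cong₂ _+_ (eq n ≤-refl) (sum-cong f g n λ p p<n → eq p (m<n⇒m<1+n p<n))

sum-update : (f g : ℕ → ℕ) → ∀ n q → q < n → (∀ p → p < n → p ≢ q → f p ≡ g p) →
             sum f n + g q ≡ sum g n + f q
sum-update f g (suc n) q q<1+n off with q ≟ n
... | yes refl = begin
  f n + sum f n + g n   ≡⟨ cong (λ s → f n + s + g n) (sum-cong f g n λ p p<n → off p (m<n⇒m<1+n p<n) (<⇒≢ p<n)) ⟩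
  f n + sum g n + g n   ≡⟨ +-comm (f n + sum g n) (g n) ⟩
  g n + (f n + sum g n) ≡⟨ cong (g n +_) (+-comm (f n) _) ⟩
  g n + (sum g n + f n) ≡⟨ +-assoc (g n) _ _ ⟨
  g n + sum g n + f n   ∎
  where open ≡-Reasoning
... | no q≢n = begin
  f n + sum f n + g q   ≡⟨ +-assoc (f n) _ _ ⟩
  f n + (sum f n + g q) ≡⟨ cong₂ _+_ (off n ≤-refl (q≢n ∘ sym))
                             (sum-update f g n q (≤∧≢⇒< (s≤s⁻¹ q<1+n) q≢n) (λ p p<n → off p (m<n⇒m<1+n p<n))) ⟩
  g n + (sum g n + f q) ≡⟨ +-assoc (g n) _ _ ⟨
  g n + sum g n + f q   ∎
  where open ≡-Reasoning

-- Stopping below `n` loses nothing for sets of equal size, whose profiles agree at `n`.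
dist : Subset n → Subset n → ℕ
dist {n} S T = sum (λ p → ∣ holes S p - holes T p ∣) n

dist-refl : (S : Subset n) → dist S S ≡ 0
dist-refl {n} S = go n
  where
  go : ∀ m → sum (λ p → ∣ holes S p - holes S p ∣) m ≡ 0
  go zero    = refl
  go (suc m) = cong₂ _+_ (∣n-n∣≡0 (holes S m)) (go m)

dist-sym : (S T : Subset n) → dist S T ≡ dist T S
dist-sym {n} S T = sum-cong _ _ n λ p _ → ∣-∣-comm (holes S p) (holes T p)

dist-update : (R : Subset n) → Shift S T x y →
              dist S R + ∣ holes T (toℕ y) - holes R (toℕ y) ∣ ≡ dist T R + ∣ holes S (toℕ y) - holes R (toℕ y) ∣
dist-update {n} {y = y} R s = sum-update _ _ n (toℕ y) (toℕ<n y)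
  λ p _ p≢y → cong (λ h → ∣ h - holes R p ∣) (Shift⇒holes-≢ s p p≢y)

∣suc-∣ : ∀ a b → a < b → ∣ a - b ∣ ≡ suc ∣ suc a - b ∣
∣suc-∣ zero    (suc b) _         = refl
∣suc-∣ (suc a) (suc b) (s≤s a<b) = ∣suc-∣ a b a<b

∣suc-∣-≤ : ∀ a b → ∣ suc a - b ∣ ≤ suc ∣ a - b ∣ × ∣ a - b ∣ ≤ suc ∣ suc a - b ∣
∣suc-∣-≤ zero    zero    = ≤-refl , z≤n
∣suc-∣-≤ zero    (suc b) = m≤n⇒m≤1+n (n≤1+n b) , ≤-refl
∣suc-∣-≤ (suc a) zero    = ≤-refl , m≤n⇒m≤1+n (n≤1+n _)
∣suc-∣-≤ (suc a) (suc b) = ∣suc-∣-≤ a b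

-- Going from `T` back to `S` lowers the value at `y` by one, away from that of `R`, which lies at
-- or above it.
dist-grow : (R : Subset n) → Shift S T x y → holes T (toℕ y) ≤ holes R (toℕ y) → dist S R ≡ suc (dist T R)
dist-grow {S = S} {T = T} {y = y} R s T≤R = +-cancelʳ-≡ d (dist S R) (suc (dist T R)) (begin
  dist S R + d          ≡⟨ dist-update R s ⟩
  dist T R + ∣ holes S (toℕ y) - holes R (toℕ y) ∣
                        ≡⟨ cong (dist T R +_) (∣suc-∣ _ _ (≤-trans (≤-reflexive (sym at)) T≤R)) ⟩
  dist T R + suc ∣ suc (holes S (toℕ y)) - holes R (toℕ y) ∣
                        ≡⟨ cong (λ h → dist T R + suc ∣ h - holes R (toℕ y) ∣) at ⟨
  dist T R + suc d      ≡⟨ +-suc _ _ ⟩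
  suc (dist T R) + d    ∎)
  where
  open ≡-Reasoning
  d  = ∣ holes T (toℕ y) - holes R (toℕ y) ∣
  at = Shift⇒holes-y s

balance-≤ : ∀ {a b c d} → a + c ≡ b + d → d ≤ suc c → a ≤ suc b
balance-≤ {a} {b} {c} {d} e d≤1+c = +-cancelʳ-≤ c a (suc b) (begin
  a + c      ≡⟨ e ⟩
  b + d      ≤⟨ +-monoʳ-≤ b d≤1+c ⟩
  b + suc c  ≡⟨ +-suc b c ⟩
  suc b + c  ∎)
  where open ≤-Reasoning

-- One value of the profile changes by one, and the triangle inequality at that point bounds the
-- effect in both directions.
Shift⇒dist-≤ : (R : Subset n) → Shift S T x y → dist S R ≤ suc (dist T R) × dist T R ≤ suc (dist S R)
Shift⇒dist-≤ {S = S} {T = T} {y = y} R s =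
  balance-≤ (dist-update R s) (subst (λ h → ∣ a - r ∣ ≤ suc ∣ h - r ∣) (sym at) (proj₂ (∣suc-∣-≤ a r))) ,
  balance-≤ (sym (dist-update R s)) (subst (λ h → ∣ h - r ∣ ≤ suc ∣ a - r ∣) (sym at) (proj₁ (∣suc-∣-≤ a r)))
  where
  a  = holes S (toℕ y)
  r  = holes R (toℕ y)
  at = Shift⇒holes-y s

-- The total number of holes is the value at `n`, which no slide touches since every vertex lies
-- below `n`.
slide-step : (R : Subset n) → Slide S T x y → dist S R ≤ suc (dist T R) × holes S n ≡ holes T n
slide-step {n} {S = S} {T = T} {x = x} {y = y} R (l , e , inj₁ next) =
  proj₁ (Shift⇒dist-≤ R s) , Shift⇒holes-≢ s n (>⇒≢ (toℕ<n y))
  where s = slide⇒Shift S T x y next l e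
slide-step {n} {S = S} {T = T} {x = x} {y = y} R (l , e , inj₂ next) =
  proj₂ (Shift⇒dist-≤ R s) , sym (Shift⇒holes-≢ s n (>⇒≢ (toℕ<n x)))
  where s = slide⇒Shift T S y x next e l

slides-dist : ∀ ℓ (sets : Fin (suc ℓ) → Subset n) (from to : Fin ℓ → Fin n) →
              (∀ i → Slide (sets (inject₁ i)) (sets (suc i)) (from i) (to i)) →
              dist (sets zero) (sets (fromℕ ℓ)) ≤ ℓ × holes (sets zero) n ≡ holes (sets (fromℕ ℓ)) n
slides-dist zero    sets from to slide = ≤-reflexive (dist-refl (sets zero)) , refl
slides-dist (suc ℓ) sets from to slide =
  ≤-trans (proj₁ first) (s≤s (proj₁ rest)) , trans (proj₂ first) (proj₂ rest)
  where
  first = slide-step (sets (suc (fromℕ ℓ))) (slide zero)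
  rest  = slides-dist ℓ (sets ∘ suc) (from ∘ suc) (to ∘ suc) (slide ∘ suc)

-- The lower bound for optimality, together with the invariant that decides reconfigurability.
TSSequence⇒dist-≤ : ∀ {I J : Subset n} {ℓ} → TSSequence (path n) k I J ℓ → dist I J ≤ ℓ × holes I n ≡ holes J n
TSSequence⇒dist-≤ {n} {ℓ = ℓ} τ =
  subst₂ (λ A B → dist A B ≤ ℓ × holes A n ≡ holes B n) start end
    (slides-dist ℓ sets from to λ i → leaves i , enters i , slides i)
  where open TSSequence τ

-- The lattice of profiles

-- Difference constraints only: `z 0 ≡ 0` is kept apart because `front`, which has to satisfy these,
-- may start at another value.
record Spread (n k : ℕ) (z : ℕ → ℕ) : Set where
  field
    mono : ∀ p → z p ≤ z (suc p)
    step : ∀ p → z (suc p) ≤ suc (z p)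
    gap  : Gap n k z

open Spread

cover⇒spread : (S : Subset n) → IsPathVertexCover (path n) k S → Spread n k (holes S)
cover⇒spread S cover = record { mono = holes-mono S ; step = holes-step S ; gap = cover⇒gap S cover }

-- Adding a constant commutes with the maximum, so constraints of this form pass to pointwise
-- maxima.
⊔-≤-+ : ∀ c {a b a′ b′} → a ≤ c + a′ → b ≤ c + b′ → a ⊔ b ≤ c + (a′ ⊔ b′)
⊔-≤-+ c a≤ b≤ = ≤-trans (⊔-mono-≤ a≤ b≤) (≤-reflexive (sym (+-distribˡ-⊔ c _ _)))

⊓-≤-+ : ∀ c {a b a′ b′} → a ≤ c + a′ → b ≤ c + b′ → a ⊓ b ≤ c + (a′ ⊓ b′)
⊓-≤-+ c a≤ b≤ = ≤-trans (⊓-mono-≤ a≤ b≤) (≤-reflexive (sym (+-distribˡ-⊓ c _ _)))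

Spread-⊔ : ∀ {z w} → Spread n k z → Spread n k w → Spread n k (λ p → z p ⊔ w p)
Spread-⊔ {k = k} Z W = record
  { mono = λ p → ⊔-mono-≤ (mono Z p) (mono W p)
  ; step = λ p → ⊔-≤-+ 1 (step Z p) (step W p)
  ; gap  = λ p h → ⊔-≤-+ k (gap Z p h) (gap W p h)
  }

Spread-⊓ : ∀ {z w} → Spread n k z → Spread n k w → Spread n k (λ p → z p ⊓ w p)
Spread-⊓ {k = k} Z W = record
  { mono = λ p → ⊓-mono-≤ (mono Z p) (mono W p)
  ; step = λ p → ⊓-≤-+ 1 (step Z p) (step W p)
  ; gap  = λ p h → ⊓-≤-+ k (gap Z p h) (gap W p h)
  }

-- The bound within one stage: positions before `x` have already been lowered from `suc e` to `e`.
front : ℕ → ℕ → ℕ → ℕ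
front e zero    p       = suc e
front e (suc x) zero    = e
front e (suc x) (suc p) = front e x p

front-≢ : ∀ e x p → p ≢ x → front e (suc x) p ≡ front e x p
front-≢ e zero    zero    p≢x = contradiction refl p≢x
front-≢ e zero    (suc p) p≢x = refl
front-≢ e (suc x) zero    p≢x = refl
front-≢ e (suc x) (suc p) p≢x = front-≢ e x p (p≢x ∘ cong suc)

front-at : ∀ e x → front e x x ≡ suc e
front-at e zero    = refl
front-at e (suc x) = front-at e x

front-< : ∀ e x p → p < x → front e x p ≡ e
front-< e (suc x) zero    p<x       = refl
front-< e (suc x) (suc p) (s≤s p<x) = front-< e x p p<x

front-≥ : ∀ e x p → e ≤ front e x p
front-≥ e zero    p       = n≤1+n e
front-≥ e (suc x) zero    = ≤-refl
front-≥ e (suc x) (suc p) = front-≥ e x p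

front-≤ : ∀ e x p → front e x p ≤ suc e
front-≤ e zero    p       = ≤-refl
front-≤ e (suc x) zero    = n≤1+n e
front-≤ e (suc x) (suc p) = front-≤ e x p

front-mono : ∀ e x p → front e x p ≤ front e x (suc p)
front-mono e zero    p       = ≤-refl
front-mono e (suc x) zero    = front-≥ e x 0
front-mono e (suc x) (suc p) = front-mono e x p

-- The bound rises by at most one over any window, and one is less than `k`.
front-spread : ∀ e x → 2 ≤ k → Spread n k (front e x)
front-spread e x 2≤k = record
  { mono = front-mono e x
  ; step = λ p → ≤-trans (front-≤ e x (suc p)) (s≤s (front-≥ e x p))
  ; gap  = λ p _ → ≤-trans (s≤s (front-≤ e x _)) (+-mono-≤ 2≤k (front-≥ e x p))
  }

-- `near` pulled up towards `far` as far as `b` allows: a large bound gives the maximum, the bound 0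
-- gives back `near`.
raise : (near far b : ℕ → ℕ) → ℕ → ℕ
raise near far b p = near p ⊔ (far p ⊓ b p)

-- Either `a` is at or above both cutoffs or `c` is at or below both, so neither cutoff is felt.
raise-idle : ∀ a c e → e < a ⊎ c ≤ e → a ⊔ (c ⊓ e) ≡ a ⊔ (c ⊓ suc e)
raise-idle a c e (inj₁ e<a) = trans (m≥n⇒m⊔n≡m (≤-trans (m⊓n≤n c e) (<⇒≤ e<a)))
                                    (sym (m≥n⇒m⊔n≡m (≤-trans (m⊓n≤n c (suc e)) e<a)))
raise-idle a c e (inj₂ c≤e) = cong (a ⊔_) (trans (m≤n⇒m⊓n≡m c≤e) (sym (m≤n⇒m⊓n≡m (m≤n⇒m≤1+n c≤e))))

raise-active : ∀ {a c e} → a ≤ e → e ≤ c → a ⊔ (c ⊓ e) ≡ e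
raise-active {a} a≤e e≤c = trans (cong (a ⊔_) (m≥n⇒m⊓n≡n e≤c)) (m≤n⇒m⊔n≡n a≤e)

HasProfile : (ℕ → ℕ) → Subset n → Set
HasProfile {n} z S = ∀ p → p ≤ n → holes S p ≡ z p

PVC : ℕ → Subset n → Set
PVC {n} k = IsPathVertexCover (path n) k

realise : ∀ {z} → Spread n (suc k) z → z 0 ≡ 0 → ∃ λ (S : Subset n) → PVC (suc k) S × HasProfile z S
realise {n} {k} {z} Z z0 = fill n z , gap⇒cover (fill n z) fill-gap , profile
  where
  profile : HasProfile z (fill n z)
  profile p p≤n = trans (sym (+-identityʳ _))
    (trans (cong (holes (fill n z) p +_) (sym z0)) (holes-fill n z (mono Z) (step Z) p p≤n))
  fill-gap : Gap n (suc k) (holes (fill n z))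
  fill-gap p h rewrite profile (p + suc k) h | profile p (m+n≤o⇒m≤o p h) = gap Z p h

-- Lowering the bound at x by one slides a token back from x to x - 1.
lower : ∀ {near far e w} (x : Fin n) → 2 ≤ suc k → Spread n (suc k) near → Spread n (suc k) far →
        near 0 ≡ 0 → far 0 ≡ 0 → near (toℕ x) ≤ e → e < far (toℕ x) → toℕ x ≡ suc (toℕ w) →
        HasProfile (raise near far (front e (toℕ x))) T →
        ∃ λ S → PVC (suc k) S × Shift S T w x × HasProfile (raise near far (front e (suc (toℕ x)))) S
lower {n} {k} {T = T} {near} {far} {e} {w} x 2≤k N F n0 f0 near≤e e<far x≡1+w T-profile =
  let S , cover , S-profile = realise (Spread-⊔ N (Spread-⊓ F (front-spread e (suc (toℕ x)) 2≤k)))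
                                      (cong₂ (λ a c → a ⊔ (c ⊓ e)) n0 f0)
  in S , cover , holes⇒Shift S T w x x≡1+w
       -- Away from `x` the two fronts agree; at `x` the profile is `suc e` under the old one and
       -- `e` under the new one.
       (λ p p≤n p≢x → trans (S-profile p p≤n)
         (trans (cong (λ b → near p ⊔ (far p ⊓ b)) (front-≢ e (toℕ x) p p≢x)) (sym (T-profile p p≤n))))
       (trans (T-profile (toℕ x) x≤n)
         (trans (cong (λ b → near (toℕ x) ⊔ (far (toℕ x) ⊓ b)) (front-at e (toℕ x)))
         (trans (raise-active (m≤n⇒m≤1+n near≤e) e<far)
         (cong suc (sym (trans (S-profile (toℕ x) x≤n)
           (trans (cong (λ b → near (toℕ x) ⊔ (far (toℕ x) ⊓ b)) (front-< e (suc (toℕ x)) (toℕ x) ≤-refl))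
             (raise-active near≤e (<⇒≤ e<far)))))))))
     , S-profile
  where
  x≤n = <⇒≤ (toℕ<n x)

-- Walks

Moves : ℕ → Set
Moves n = List (Fin n × Fin n)

data Walk {n} (k : ℕ) : Subset n → Subset n → Moves n → Set where
  stay  : PVC k S → Walk k S S []
  slide : ∀ {R ms} → PVC k S → Slide S T x y → Walk k T R ms → Walk k S R ((x , y) ∷ ms)

Walk-∷ʳ : ∀ {R S : Subset n} {ms} → Walk k R S ms → Slide S T x y → PVC k T → Walk k R T (ms ∷ʳ (x , y))
Walk-∷ʳ (stay c)      s d = slide c s (stay d)
Walk-∷ʳ (slide c r w) s d = slide c r (Walk-∷ʳ w s d)

walkSets : {S T : Subset n} {ms : Moves n} → Walk k S T ms → Fin (suc (length ms)) → Subset n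
walkSets {S = S} _           zero    = S
walkSets         (slide _ _ w) (suc i) = walkSets w i

walkCovers : {S T : Subset n} {ms : Moves n} (w : Walk k S T ms) → ∀ i → PVC k (walkSets w i)
walkCovers (stay c)      zero    = c
walkCovers (slide c _ w) zero    = c
walkCovers (slide _ _ w) (suc i) = walkCovers w i

walkEnd : {S T : Subset n} {ms : Moves n} (w : Walk k S T ms) → walkSets w (fromℕ (length ms)) ≡ T
walkEnd (stay c)      = refl
walkEnd (slide _ _ w) = walkEnd w

walkSlides : {S T : Subset n} {ms : Moves n} (w : Walk k S T ms) → ∀ i →
             Slide (walkSets w (inject₁ i)) (walkSets w (suc i)) (proj₁ (List.lookup ms i)) (proj₂ (List.lookup ms i))
walkSlides (slide _ s w) zero    = s
walkSlides (slide _ _ w) (suc i) = walkSlides w i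

walk⇒TSSequence : {S T : Subset n} {ms : Moves n} → Walk k S T ms → TSSequence (path n) k S T (length ms)
walk⇒TSSequence {ms = ms} w = record
  { sets   = walkSets w
  ; covers = walkCovers w
  ; start  = refl
  ; end    = walkEnd w
  ; from   = proj₁ ∘ List.lookup ms
  ; to     = proj₂ ∘ List.lookup ms
  ; leaves = proj₁ ∘ walkSlides w
  ; enters = proj₁ ∘ proj₂ ∘ walkSlides w
  ; slides = proj₂ ∘ proj₂ ∘ walkSlides w
  }

-- The program

-- Only an upper bound on the time is kept, so that branches of different lengths can be joined.
Runs : Program → State → (State → Set) → ℕ → Set
Runs p s Q c = ∃[ s′ ] ∃[ t ] (Exec p s s′ t × t ≤ c × Q s′)

private
  variable
    prog prog₁ prog₂ : Program
    s : State
    Q R : State → Set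
    c c₁ c₂ : ℕ

run-assign : ∀ {r e} → Q (record s { reg = reg s [ r ↦ eval e s ] }) → Runs (r ≔ e) s Q 1
run-assign q = _ , _ , assign , ≤-refl , q

assign-then : ∀ {r e} → Runs prog (record s { reg = reg s [ r ↦ eval e s ] }) Q c →
              Runs ((r ≔ e) ⨾ prog) s Q (suc c)
assign-then (_ , _ , ex , t≤c , q) = _ , _ , seq assign ex , s≤s t≤c , q

store-then : ∀ {r v} → Runs prog (record s { mem = mem s [ reg s r ↦ reg s v ] }) Q c →
             Runs (store r v ⨾ prog) s Q (suc c)
store-then (_ , _ , ex , t≤c , q) = _ , _ , seq store ex , s≤s t≤c , q

run-then : Runs prog₁ s R c₁ → (∀ s′ → R s′ → Runs prog₂ s′ Q c₂) → Runs (prog₁ ⨾ prog₂) s Q (c₁ + c₂)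
run-then (s′ , _ , ex , t≤c , r) next with next s′ r
... | _ , _ , ex′ , t′≤c′ , q = _ , _ , seq ex ex′ , +-mono-≤ t≤c t′≤c′ , q

run-ifz : ∀ {r} → (reg s r ≡ 0 → Runs prog₁ s Q c) → (reg s r ≢ 0 → Runs prog₂ s Q c) →
          Runs (ifz r prog₁ prog₂) s Q (suc c)
run-ifz {s = s} {r = r} zer nonzer with reg s r ≟ 0
... | yes e with _ , _ , ex , t≤c , q ← zer e   = _ , _ , if-zero e ex , s≤s t≤c , q
... | no  e with _ , _ , ex , t≤c , q ← nonzer e = _ , _ , if-nonzero e ex , s≤s t≤c , q

run-weaken : c₁ ≤ c₂ → Runs prog s Q c₁ → Runs prog s Q c₂
run-weaken c₁≤c₂ (_ , _ , ex , t≤c , q) = _ , _ , ex , ≤-trans t≤c c₁≤c₂ , q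

-- The invariant is indexed by the number of iterations left, which the loop register holds. Each
-- iteration costs one test besides its body, and the final test gives the extra step.
run-while : ∀ {r} (Inv : ℕ → State → Set) → (∀ {i s} → Inv i s → reg s r ≡ i) →
            (∀ i s → Inv (suc i) s → Runs prog s (Inv i) c) →
            ∀ i s → Inv i s → Runs (while r prog) s (Inv 0) (suc (i * suc c))
run-while Inv counter body zero    s inv = _ , _ , while-stop (counter inv) , ≤-refl , inv
run-while {c = c} Inv counter body (suc i) s inv
  with s′ , t , ex , t≤c , inv′ ← body i s inv
  with _ , u , ex′ , u≤ , q ← run-while Inv counter body i s′ inv′ =
  _ , _ , while-step (λ e → 1+n≢0 (trans (sym (counter inv)) e)) ex ex′ ,
  s≤s (≤-trans (+-mono-≤ t≤c u≤) (≤-reflexive (+-suc c _))) , q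

-- The output convention reserves registers 0 and 1 for length and start address; register 0 also
-- brings in `n`, which `setup` saves first.
rLen rLo rN rHi rD rX rI rJ rOne rRem rT rU : Reg
rLen = 0
rLo  = 1
rN   = 2
rHi  = 3
rD   = 4
rX   = 5
rI   = 6
rJ   = 7
rOne = 8
rRem = 9
rT   = 10
rU   = 11

prependMove appendMove emit advance stage setup shortestTS : Program

-- Addresses decrease here, so the target of the move is written before its source.
prependMove =
  rLo ≔ sub rLo rOne ⨾ store rLo rX ⨾ rT ≔ sub rX rOne ⨾ rLo ≔ sub rLo rOne ⨾ store rLo rT ⨾
  rLen ≔ add rOne rLen

appendMove =
  store rHi rX ⨾ rHi ≔ add rOne rHi ⨾ rT ≔ sub rX rOne ⨾ store rHi rT ⨾ rHi ≔ add rOne rHi ⨾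
  rLen ≔ add rOne rLen

-- rI and rJ hold the numbers of holes of I and J below rX.
emit =
  rT ≔ sub rD rJ ⨾ rU ≔ sub rD rI ⨾
  ifz rT (ifz rU (rT ≔ const 0) prependMove) (ifz rU appendMove (rT ≔ const 0))

-- Adding one before subtracting the membership bit keeps the truncated subtraction exact.
advance =
  rT ≔ load rX ⨾ rI ≔ add rOne rI ⨾ rI ≔ sub rI rT ⨾
  rT ≔ add rN rX ⨾ rT ≔ load rT ⨾ rJ ≔ add rOne rJ ⨾ rJ ≔ sub rJ rT ⨾
  rX ≔ add rOne rX ⨾ rRem ≔ sub rRem rOne

stage =
  rX ≔ const 0 ⨾ rI ≔ const 0 ⨾ rJ ≔ const 0 ⨾ rRem ≔ copy rN ⨾
  while rRem (emit ⨾ advance) ⨾ rD ≔ sub rD rOne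

-- The output grows in both directions from the address 2n + 2n², which leaves
-- room below for one move per iteration of the double loop.
setup =
  rN ≔ copy rLen ⨾ rLen ≔ const 0 ⨾ rOne ≔ const 1 ⨾ rLo ≔ add rN rN ⨾ rHi ≔ copy rLo ⨾ rRem ≔ copy rN ⨾
  while rRem (rLo ≔ add rLo rHi ⨾ rRem ≔ sub rRem rOne)

shortestTS = setup ⨾ rHi ≔ copy rLo ⨾ rD ≔ copy rN ⨾ while rD stage

-- The body of the loop in `setup` takes 2 steps; in the inner loop `emit` takes at most 10 and
-- `advance` 9. Every loop test adds one.
time : ℕ → ℕ
time n = 7 + n * 3 + (3 + n * (7 + n * 20))

time-quadratic : time ∈O (λ n → n ^ 2)
-- With `n = 1 + m`, the polynomial `20 m² + 30 m` is exactly the slack between `time n` and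
-- `40 n²`.
time-quadratic = 40 , 1 , λ { (suc m) _ → m+n≤o⇒m≤o _ (≤-reflexive (solve 1
  (λ m → let n = con 1 :+ m in
         con 7 :+ n :* con 3 :+ (con 3 :+ n :* (con 7 :+ n :* con 20)) :+ (con 20 :* m :* m :+ con 30 :* m)
         := con 40 :* (n :^ 2)) refl m)) }
  where open +-*-Solver

-- Memory updates and stored move lists

update-≡ : ∀ f a v → (f [ a ↦ v ]) a ≡ v
update-≡ f a v with a ≡ᵇ a in eq
... | true  = refl
... | false with () ← subst Bool.T eq (≡⇒≡ᵇ a a refl)

update-≢ : ∀ f a v b → a ≢ b → (f [ a ↦ v ]) b ≡ f b
update-≢ f a v b a≢b with a ≡ᵇ b in eq
... | true  = contradiction (≡ᵇ⇒≡ a b (subst Bool.T (sym eq) _)) a≢b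
... | false = refl

Stored : (ℕ → ℕ) → ℕ → Moves n → Set
Stored m a []             = ⊤
Stored m a ((x , y) ∷ ms) = m a ≡ toℕ x × m (suc a) ≡ toℕ y × Stored m (suc (suc a)) ms

endAddress : ℕ → Moves n → ℕ
endAddress a []       = a
endAddress a (_ ∷ ms) = endAddress (suc (suc a)) ms

endAddress-≥ : ∀ a (ms : Moves n) → a ≤ endAddress a ms
endAddress-≥ a []       = ≤-refl
endAddress-≥ a (_ ∷ ms) = ≤-trans (≤-trans (n≤1+n a) (n≤1+n _)) (endAddress-≥ (suc (suc a)) ms)

endAddress-∷ʳ : ∀ a (ms : Moves n) move → endAddress a (ms ∷ʳ move) ≡ suc (suc (endAddress a ms))
endAddress-∷ʳ a []       move = refl
endAddress-∷ʳ a (_ ∷ ms) move = endAddress-∷ʳ (suc (suc a)) ms move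

Stored-cong : ∀ {m m′} a (ms : Moves n) → (∀ q → a ≤ q → q < endAddress a ms → m q ≡ m′ q) →
              Stored m a ms → Stored m′ a ms
Stored-cong a []       eq st = _
Stored-cong a (_ ∷ ms) eq (e , e′ , st) =
  trans (sym (eq a ≤-refl (≤-trans (n≤1+n _) end))) e ,
  trans (sym (eq (suc a) (n≤1+n a) end)) e′ ,
  Stored-cong (suc (suc a)) ms (λ q a≤q → eq q (≤-trans (≤-trans (n≤1+n a) (n≤1+n _)) a≤q)) st
  where end = endAddress-≥ (suc (suc a)) ms

Stored-∷ʳ : ∀ {m} a (ms : Moves n) → Stored m a ms →
            m (endAddress a ms) ≡ toℕ x → m (suc (endAddress a ms)) ≡ toℕ y → Stored m a (ms ∷ʳ (x , y))
Stored-∷ʳ a []       st            f f′ = f , f′ , _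
Stored-∷ʳ a (_ ∷ ms) (e , e′ , st) f f′ = e , e′ , Stored-∷ʳ (suc (suc a)) ms st f f′

Stored-lookup : ∀ {m} a (ms : Moves n) → Stored m a ms → ∀ i →
                m (a + 2 * toℕ i) ≡ toℕ (proj₁ (List.lookup ms i)) ×
                m (suc (a + 2 * toℕ i)) ≡ toℕ (proj₂ (List.lookup ms i))
Stored-lookup {m = m} a ((x , y) ∷ ms) (e , e′ , st) zero =
  trans (cong m (+-identityʳ a)) e , trans (cong (m ∘ suc) (+-identityʳ a)) e′
Stored-lookup {m = m} a (_ ∷ ms) (_ , _ , st) (suc i) with Stored-lookup (suc (suc a)) ms st i
... | f , f′ = trans (cong m shift) f , trans (cong (m ∘ suc) shift) f′
  where
  shift : a + 2 * suc (toℕ i) ≡ suc (suc a) + 2 * toℕ i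
  shift = trans (cong (a +_) (*-suc 2 (toℕ i))) (trans (+-suc a _) (cong suc (+-suc a _)))

bit : Bool.Bool → ℕ
bit b = if b then 1 else 0

bits : Subset n → ℕ → ℕ
bits S = contents (List.map bit (toList S))

bits-lookup : (S : Subset n) (v : Fin n) → bits S (toℕ v) ≡ bit (lookup S v)
bits-lookup (b ∷ S) zero    = refl
bits-lookup (b ∷ S) (suc v) = bits-lookup S v

bits-++ˡ : ∀ {m} (S : Subset n) (T : Subset m) v → bits (S ++ T) (toℕ v) ≡ bit (lookup S v)
bits-++ˡ (b ∷ S) T zero    = refl
bits-++ˡ (b ∷ S) T (suc v) = bits-++ˡ S T v

bits-++ʳ : ∀ {m} (S : Subset n) (T : Subset m) p → bits (S ++ T) (n + p) ≡ bits T p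
bits-++ʳ []      T p = refl
bits-++ʳ (_ ∷ S) T p = bits-++ʳ S T p

holes-bit : (S : Subset n) (v : Fin n) → suc (holes S (toℕ v)) ∸ bit (lookup S v) ≡ holes S (suc (toℕ v))
holes-bit S v = trans (go (lookup S v)) (sym (holes-suc S v))
  where
  go : ∀ b → suc (holes S (toℕ v)) ∸ bit b ≡ hole b + holes S (toℕ v)
  go inside  = refl
  go outside = refl

-- Sweeping the bound from `n` down to 0

module Sweep {n k} (2≤k : 2 ≤ suc k) (I J : Subset n) (I-cover : PVC (suc k) I) (J-cover : PVC (suc k) J)
             (same-holes : holes I n ≡ holes J n) where

  -- The invariant of the sweep: the ends are the two covers with profiles pulled up to the bound,
  -- and the walk between them is already as short as possible.
  record Partial (b : ℕ → ℕ) (ms : Moves n) : Set where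
    field
      {first last}  : Subset n
      first-profile : HasProfile (raise (holes I) (holes J) b) first
      last-profile  : HasProfile (raise (holes J) (holes I) b) last
      walk          : Walk (suc k) first last ms
      length≡dist   : length ms ≡ dist first last

  -- Profiles never exceed `n`, so this bound cuts nothing off and both ends are the same set.
  begin-sweep : Partial (λ _ → n) []
  begin-sweep = record
    { first-profile = λ p p≤n → trans (profile p p≤n) (cong (holes I p ⊔_) (sym (m≤n⇒m⊓n≡m (holes-≤ J p))))
    ; last-profile  = λ p p≤n → trans (profile p p≤n) (trans (⊔-comm (holes I p) (holes J p))
                                  (cong (holes J p ⊔_) (sym (m≤n⇒m⊓n≡m (holes-≤ I p)))))
    ; walk          = stay cover
    ; length≡dist   = sym (dist-refl union)
    }
    where
    top = realise (Spread-⊔ (cover⇒spread I I-cover) (cover⇒spread J J-cover))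
                  (cong₂ _⊔_ (holes-zero I) (holes-zero J))
    union   = proj₁ top
    cover   = proj₁ (proj₂ top)
    profile = proj₂ (proj₂ top)

  end-sweep : ∀ {ms} → Partial (λ _ → 0) ms → Walk (suc k) I J ms × length ms ≡ dist I J
  end-sweep {ms} π = subst₂ (λ A B → Walk (suc k) A B ms × length ms ≡ dist A B)
    (holes-injective first I λ p p≤n → trans (first-profile p p≤n) (at-0 (holes I p) (holes J p)))
    (holes-injective last  J λ p p≤n → trans (last-profile p p≤n) (at-0 (holes J p) (holes I p)))
    (walk , length≡dist)
    where
    open Partial π
    at-0 : ∀ a c → a ⊔ (c ⊓ 0) ≡ a
    at-0 a c = trans (cong (a ⊔_) (⊓-zeroʳ c)) (⊔-identityʳ a)

  -- On positions up to `n` the two bounds differ only at `n`. There the profiles of `I` and `J`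
  -- agree, as the sets have equal size, and absorption removes the bound.
  end-stage : ∀ {e ms} → Partial (front e n) ms → Partial (λ _ → e) ms
  end-stage {e} π = record
    { first-profile = λ p p≤n → trans (first-profile p p≤n) (lemma (holes I) (holes J) same-holes p p≤n)
    ; last-profile  = λ p p≤n → trans (last-profile p p≤n) (lemma (holes J) (holes I) (sym same-holes) p p≤n)
    ; walk          = walk
    ; length≡dist   = length≡dist
    }
    where
    open Partial π
    lemma : ∀ z w → z n ≡ w n → ∀ p → p ≤ n → raise z w (front e n) p ≡ raise z w (λ _ → e) p
    lemma z w eq p p≤n with p ≟ n
    ... | no p≢n   = cong (λ b → z p ⊔ (w p ⊓ b)) (front-< e n p (≤∧≢⇒< p≤n p≢n))
    ... | yes refl rewrite eq = trans (⊔-absorbs-⊓ (w n) _) (sym (⊔-absorbs-⊓ (w n) _))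

  module _ {e ms} (x : Fin n) (π : Partial (front e (toℕ x)) ms) where
    open Partial π

    private
      keep : ∀ z w (S : Subset n) → HasProfile (raise z w (front e (toℕ x))) S → e < z (toℕ x) ⊎ w (toℕ x) ≤ e →
             HasProfile (raise z w (front e (suc (toℕ x)))) S
      keep z w S profile idle p p≤n = trans (profile p p≤n) (eq (p ≟ toℕ x))
        where
        eq : _ → raise z w (front e (toℕ x)) p ≡ raise z w (front e (suc (toℕ x))) p
        eq (no p≢x)   = cong (λ b → z p ⊔ (w p ⊓ b)) (sym (front-≢ e (toℕ x) p p≢x))
        eq (yes refl) = trans (cong (λ b → z p ⊔ (w p ⊓ b)) (front-at e p))
          (trans (sym (raise-idle (z p) (w p) e idle))
                 (cong (λ b → z p ⊔ (w p ⊓ b)) (sym (front-< e (suc p) p ≤-refl))))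

      -- Supplies the hypothesis of `dist-grow`: at `x`, the end about to change is at most `suc e`,
      -- and the other end is at least the larger of the two profiles.
      below : ∀ z w S R → HasProfile (raise z w (front e (toℕ x))) S →
              HasProfile (raise w z (front e (toℕ x))) R →
              z (toℕ x) ≤ e → e < w (toℕ x) → holes S (toℕ x) ≤ holes R (toℕ x)
      below z w S R S-profile R-profile z≤e e<w = begin
        holes S (toℕ x)                                   ≡⟨ S-profile (toℕ x) x≤n ⟩
        z (toℕ x) ⊔ (w (toℕ x) ⊓ front e (toℕ x) (toℕ x)) ≤⟨ ⊔-lub (m≤n⇒m≤1+n z≤e) (≤-trans (m⊓n≤n (w (toℕ x)) _) (front-≤ e (toℕ x) (toℕ x))) ⟩
        suc e                                             ≤⟨ e<w ⟩
        w (toℕ x)                                         ≤⟨ m≤m⊔n (w (toℕ x)) _ ⟩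
        w (toℕ x) ⊔ (z (toℕ x) ⊓ front e (toℕ x) (toℕ x)) ≡⟨ R-profile (toℕ x) x≤n ⟨
        holes R (toℕ x)                                   ∎
        where
        open ≤-Reasoning
        x≤n = <⇒≤ (toℕ<n x)

      -- All profiles vanish at 0, so a value above `e` rules out `x = 0`.
      predecessor : (S : Subset n) → e < holes S (toℕ x) → ∃ λ w → toℕ x ≡ suc (toℕ w)
      predecessor S e<h = go x e<h
        where
        go : (x : Fin n) → e < holes S (toℕ x) → ∃ λ (w : Fin n) → toℕ x ≡ suc (toℕ w)
        go zero    e<h = contradiction (≤-trans e<h (≤-reflexive (holes-zero S))) λ ()
        go (suc x) e<h = inject₁ x , cong suc (sym (toℕ-inject₁ x))

    skip : e < holes I (toℕ x) ⊎ holes J (toℕ x) ≤ e → e < holes J (toℕ x) ⊎ holes I (toℕ x) ≤ e →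
           Partial (front e (suc (toℕ x))) ms
    skip idle-first idle-last = record
      { first-profile = keep (holes I) (holes J) first first-profile idle-first
      ; last-profile  = keep (holes J) (holes I) last last-profile idle-last
      ; walk          = walk
      ; length≡dist   = length≡dist
      }

    -- Only the last set changes, and the new final move takes a token back from `x`. The shift
    -- leads from the new set to the old one, hence it is reversed.
    append : holes J (toℕ x) ≤ e → e < holes I (toℕ x) →
             ∃ λ w → toℕ x ≡ suc (toℕ w) × Partial (front e (suc (toℕ x))) (ms ∷ʳ (x , w))
    append J≤e e<I with predecessor I e<I
    ... | w , x≡1+w with lower x 2≤k (cover⇒spread J J-cover) (cover⇒spread I I-cover) (holes-zero J) (holes-zero I)
                               J≤e e<I x≡1+w last-profile
    ... | S , cover , shift , profile = w , x≡1+w , record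
      { first-profile = keep (holes I) (holes J) first first-profile (inj₁ e<I)
      ; last-profile  = profile
      ; walk          = Walk-∷ʳ walk (Shift⇒slide⁻¹ shift) cover
      ; length≡dist   = begin
          length (ms ∷ʳ (x , w))  ≡⟨ length-++ ms ⟩
          length ms + 1           ≡⟨ +-comm (length ms) 1 ⟩
          suc (length ms)         ≡⟨ cong suc (trans length≡dist (dist-sym first last)) ⟩
          suc (dist last first)   ≡⟨ dist-grow first shift (below (holes J) (holes I) last first last-profile first-profile J≤e e<I) ⟨
          dist S first            ≡⟨ dist-sym S first ⟩
          dist first S            ∎
      }
      where open ≡-Reasoning

    prepend : holes I (toℕ x) ≤ e → e < holes J (toℕ x) →
              ∃ λ w → toℕ x ≡ suc (toℕ w) × Partial (front e (suc (toℕ x))) ((w , x) ∷ ms)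
    prepend I≤e e<J with predecessor J e<J
    ... | w , x≡1+w with lower x 2≤k (cover⇒spread I I-cover) (cover⇒spread J J-cover) (holes-zero I) (holes-zero J)
                               I≤e e<J x≡1+w first-profile
    ... | S , cover , shift , profile = w , x≡1+w , record
      { first-profile = profile
      ; last-profile  = keep (holes J) (holes I) last last-profile (inj₁ e<J)
      ; walk          = slide cover (Shift⇒slide shift) walk
      ; length≡dist   = trans (cong suc length≡dist)
                              (sym (dist-grow last shift (below (holes I) (holes J) first last first-profile last-profile I≤e e<J)))
      }

  -- `room` counts the moves that may still be prepended, at two cells each; the `n + n` input cells
  -- below must survive, as every stage reads them again.
  record Output (b : ℕ → ℕ) (room lo hi len : ℕ) (m : ℕ → ℕ) : Set where
    field
      moves   : Moves n
      partial : Partial b moves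
      stored  : Stored m lo moves
      hi≡     : hi ≡ endAddress lo moves
      len≡    : len ≡ length moves
      room≤   : n + n + (room + room) ≤ lo
      cellsI  : ∀ v → m (toℕ v) ≡ bit (lookup I v)
      cellsJ  : ∀ v → m (n + toℕ v) ≡ bit (lookup J v)

  Output-map : ∀ {b b′ room room′ lo hi len m} → (∀ {ms} → Partial b ms → Partial b′ ms) → room′ ≤ room →
               Output b room lo hi len m → Output b′ room′ lo hi len m
  Output-map f room′≤room o = record
    { moves   = moves
    ; partial = f partial
    ; stored  = stored
    ; hi≡     = hi≡
    ; len≡    = len≡
    ; room≤   = ≤-trans (+-monoʳ-≤ (n + n) (+-mono-≤ room′≤room room′≤room)) room≤
    ; cellsI  = cellsI
    ; cellsJ  = cellsJ
    }
    where open Output o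

  module _ {e room lo hi len m} (x : Fin n) (o : Output (front e (toℕ x)) (suc room) lo hi len m) where
    open Output o

    private
      room≤′ : suc (suc (n + n + (room + room))) ≤ lo
      room≤′ = ≤-trans (≤-reflexive (sym (trans (cong (n + n +_) (cong suc (+-suc room room)))
                                          (trans (+-suc (n + n) _) (cong suc (+-suc (n + n) _)))))) room≤

      inputs<lo : ∀ (v : Fin n) → 3 + (n + toℕ v) ≤ lo × 3 + toℕ v ≤ lo
      inputs<lo v = below , ≤-trans (+-monoʳ-≤ 3 (m≤n+m (toℕ v) n)) below
        where
        below : 3 + (n + toℕ v) ≤ lo
        below = ≤-trans (+-monoʳ-≤ 2 (≤-trans (≤-reflexive (sym (+-suc n (toℕ v))))
                  (≤-trans (+-monoʳ-≤ n (toℕ<n v)) (m≤m+n (n + n) _)))) room≤′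

      inputs<hi : ∀ (v : Fin n) → n + toℕ v < hi × toℕ v < hi
      inputs<hi v = ≤-trans (m≤n+m _ 2) (≤-trans (proj₁ (inputs<lo v)) lo≤hi)
                  , ≤-trans (m≤n+m _ 2) (≤-trans (proj₂ (inputs<lo v)) lo≤hi)
        where
        lo≤hi : lo ≤ hi
        lo≤hi = ≤-trans (endAddress-≥ lo moves) (≤-reflexive (sym hi≡))

    append-output : holes J (toℕ x) ≤ e → e < holes I (toℕ x) →
      Output (front e (suc (toℕ x))) room lo (suc (suc hi)) (suc len)
             ((m [ hi ↦ toℕ x ]) [ suc hi ↦ toℕ x ∸ 1 ])
    append-output J≤e e<I with append x partial J≤e e<I
    ... | w , x≡1+w , partial′ = record
      { moves   = moves ∷ʳ (x , w)
      ; partial = partial′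
      ; stored  = Stored-∷ʳ lo moves
                    (Stored-cong lo moves (λ q _ q<end → sym (unchanged q (≤-trans q<end (≤-reflexive (sym hi≡))))) stored)
                    (trans (cong m′ (sym hi≡))
                      (trans (update-≢ m₁ (suc hi) _ hi 1+n≢n) (update-≡ m hi (toℕ x))))
                    (trans (cong (m′ ∘ suc) (sym hi≡))
                      (trans (update-≡ m₁ (suc hi) _) (cong (_∸ 1) x≡1+w)))
      ; hi≡     = trans (cong (λ h → suc (suc h)) hi≡) (sym (endAddress-∷ʳ lo moves _))
      ; len≡    = trans (cong suc len≡) (trans (+-comm 1 _) (sym (length-++ moves)))
      ; room≤   = ≤-trans (m≤n+m _ 2) room≤′
      ; cellsI  = λ v → trans (unchanged _ (proj₂ (inputs<hi v))) (cellsI v)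
      ; cellsJ  = λ v → trans (unchanged _ (proj₁ (inputs<hi v))) (cellsJ v)
      }
      where
      m₁ m′ : ℕ → ℕ
      m₁ = m [ hi ↦ toℕ x ]
      m′ = m₁ [ suc hi ↦ toℕ x ∸ 1 ]
      unchanged : ∀ q → q < hi → m′ q ≡ m q
      unchanged q q<hi = trans (update-≢ m₁ (suc hi) _ q (>⇒≢ (m<n⇒m<1+n q<hi))) (update-≢ m hi _ q (>⇒≢ q<hi))

    prepend-output : holes I (toℕ x) ≤ e → e < holes J (toℕ x) →
      Output (front e (suc (toℕ x))) room (lo ∸ 1 ∸ 1) hi (suc len)
             ((m [ lo ∸ 1 ↦ toℕ x ]) [ lo ∸ 1 ∸ 1 ↦ toℕ x ∸ 1 ])
    -- `lo` is generalised so that matching can exhibit it as `2 + l`, where the truncated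
    -- subtractions compute; `room≤′` excludes 0 and 1.
    prepend-output I≤e e<J = go lo refl
      where
      go : ∀ l → l ≡ lo → Output (front e (suc (toℕ x))) room (l ∸ 1 ∸ 1) hi (suc len)
                                 ((m [ l ∸ 1 ↦ toℕ x ]) [ l ∸ 1 ∸ 1 ↦ toℕ x ∸ 1 ])
      go zero          refl = contradiction room≤′ λ ()
      go (suc zero)    refl = contradiction room≤′ λ { (s≤s ()) }
      go (suc (suc l)) refl with prepend x partial I≤e e<J
      ... | w , x≡1+w , partial′ = record
        { moves   = (w , x) ∷ moves
        ; partial = partial′
        ; stored  = trans (update-≡ m₁ l _) (cong (_∸ 1) x≡1+w)
                  , trans (update-≢ m₁ l _ (suc l) (<⇒≢ ≤-refl)) (update-≡ m (suc l) _)
                  , Stored-cong lo moves (λ q lo≤q _ → sym (trans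
                      (update-≢ m₁ l _ q (<⇒≢ (≤-trans (n≤1+n _) lo≤q))) (update-≢ m (suc l) _ q (<⇒≢ lo≤q)))) stored
        ; hi≡     = hi≡
        ; len≡    = cong suc len≡
        ; room≤   = s≤s⁻¹ (s≤s⁻¹ room≤′)
        ; cellsI  = λ v → trans (unchanged _ (proj₂ (inputs<lo v))) (cellsI v)
        ; cellsJ  = λ v → trans (unchanged _ (proj₁ (inputs<lo v))) (cellsJ v)
        }
        where
        m₁ : ℕ → ℕ
        m₁ = m [ suc l ↦ toℕ x ]
        unchanged : ∀ q → 3 + q ≤ 2 + l → (m₁ [ l ↦ toℕ x ∸ 1 ]) q ≡ m q
        unchanged q 3+q≤2+l = trans (update-≢ m₁ l _ q (>⇒≢ q<l)) (update-≢ m (suc l) _ q (>⇒≢ (m<n⇒m<1+n q<l)))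
          where q<l = s≤s⁻¹ (s≤s⁻¹ 3+q≤2+l)

  -- Execution of the program

  OutputIn : (ℕ → ℕ) → ℕ → State → Set
  OutputIn b room s = Output b room (reg s rLo) (reg s rHi) (reg s rLen) (mem s)

  -- Indexed by register contents instead of a state: assignments to other registers then leave the
  -- type unchanged up to computation.
  record Counters (d x r : ℕ) (regN regD regX regI regJ regOne regRem : ℕ) : Set where
    field
      n≡   : regN ≡ n
      d≡   : regD ≡ d
      x≡   : regX ≡ x
      I≡   : regI ≡ holes I x
      J≡   : regJ ≡ holes J x
      one≡ : regOne ≡ 1
      rem≡ : regRem ≡ r

  CountersIn : ℕ → ℕ → ℕ → State → Set
  CountersIn d x r s = Counters d x r (reg s rN) (reg s rD) (reg s rX) (reg s rI) (reg s rJ) (reg s rOne) (reg s rRem)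

  -- As `rD` holds `suc e`, its truncated difference with a profile value is zero exactly if that
  -- value exceeds `e`. A move is due when this holds for just one of `I` and `J`.
  emit-run : ∀ {e r room} (x : Fin n) s →
             CountersIn (suc e) (toℕ x) r s → OutputIn (front e (toℕ x)) (suc room) s →
             Runs emit s (λ s′ → CountersIn (suc e) (toℕ x) r s′ × OutputIn (front e (suc (toℕ x))) room s′) 10
  emit-run {e} {r} {room} x s C o =
    assign-then (assign-then (run-ifz
      (λ tJ → run-ifz
        (λ tI → run-weaken (s≤s z≤n) (run-assign (C , Output-map
          (λ π → skip x π (inj₁ (above I≡ tI)) (inj₁ (above J≡ tJ))) (n≤1+n room) o)))
        (λ tI → assign-then (store-then (assign-then (assign-then (store-then (run-assign
          (C , prepended one≡ x≡ (notAbove I≡ tI) (above J≡ tJ)))))))))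
      (λ tJ → run-ifz
        (λ tI → store-then (assign-then (assign-then (store-then (assign-then (run-assign
          (C , appended one≡ x≡ (notAbove J≡ tJ) (above I≡ tI))))))))
        (λ tI → run-weaken (s≤s z≤n) (run-assign (C , Output-map
          (λ π → skip x π (inj₂ (notAbove J≡ tJ)) (inj₂ (notAbove I≡ tI))) (n≤1+n room) o))))))
    where
    open Counters C
    above : ∀ {h z} → h ≡ z → reg s rD ∸ h ≡ 0 → e < z
    above {h} refl t = m∸n≡0⇒m≤n (trans (cong (_∸ h) (sym d≡)) t)
    notAbove : ∀ {h z} → h ≡ z → reg s rD ∸ h ≢ 0 → z ≤ e
    notAbove {h} refl t = ≮⇒≥ λ e<h → t (trans (cong (_∸ h) d≡) (m≤n⇒m∸n≡0 e<h))
    appended : ∀ {one X} → one ≡ 1 → X ≡ toℕ x → holes J (toℕ x) ≤ e → e < holes I (toℕ x) →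
               Output (front e (suc (toℕ x))) room (reg s rLo) (one + (one + reg s rHi)) (one + reg s rLen)
                      ((mem s [ reg s rHi ↦ X ]) [ one + reg s rHi ↦ X ∸ one ])
    appended refl refl = append-output x o
    prepended : ∀ {one X} → one ≡ 1 → X ≡ toℕ x → holes I (toℕ x) ≤ e → e < holes J (toℕ x) →
                Output (front e (suc (toℕ x))) room (reg s rLo ∸ one ∸ one) (reg s rHi) (one + reg s rLen)
                       ((mem s [ reg s rLo ∸ one ↦ X ]) [ reg s rLo ∸ one ∸ one ↦ X ∸ one ])
    prepended refl refl = prepend-output x o

  advance-run : ∀ {d r b room} (x : Fin n) s → CountersIn d (toℕ x) (suc r) s → OutputIn b room s →
                Runs advance s (λ s′ → CountersIn d (suc (toℕ x)) r s′ × OutputIn b room s′) 9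
  advance-run x s C o =
    assign-then (assign-then (assign-then (assign-then (assign-then (assign-then (assign-then
      (assign-then (run-assign (record
        { n≡   = n≡
        ; d≡   = d≡
        ; x≡   = cong₂ _+_ one≡ x≡
        ; I≡   = next I one≡ I≡ (trans (cong (mem s) x≡) (cellsI x))
        ; J≡   = next J one≡ J≡ (trans (cong (mem s) (cong₂ _+_ n≡ x≡)) (cellsJ x))
        ; one≡ = one≡
        ; rem≡ = cong₂ _∸_ rem≡ one≡
        } , o)))))))))
    where
    open Counters C
    open Output o using (cellsI; cellsJ)
    next : ∀ (S : Subset n) {one h cell} → one ≡ 1 → h ≡ holes S (toℕ x) → cell ≡ bit (lookup S x) →
           one + h ∸ cell ≡ holes S (suc (toℕ x))
    next S refl refl refl = holes-bit S x

  -- The room is one move per iteration to come: `r` in this stage and `n` in each of the `e` stages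
  -- after it.
  StageInv : ℕ → ℕ → State → Set
  StageInv e r s = ∃ λ x → x + r ≡ n × CountersIn (suc e) x r s × OutputIn (front e x) (r + e * n) s

  step-run : ∀ e r s → StageInv e (suc r) s → Runs (emit ⨾ advance) s (StageInv e r) 19
  step-run e r s (x , x+1+r≡n , C , o) =
    at (fromℕ< x<n) (toℕ-fromℕ< x<n) 1+x+r≡n C o
    where
    1+x+r≡n : suc x + r ≡ n
    1+x+r≡n = trans (sym (+-suc x r)) x+1+r≡n
    x<n : x < n
    x<n = ≤-trans (s≤s (m≤m+n x r)) (≤-reflexive 1+x+r≡n)
    at : ∀ {y} (v : Fin n) → toℕ v ≡ y → suc y + r ≡ n → CountersIn (suc e) y (suc r) s → OutputIn (front e y) (suc r + e * n) s →
         Runs (emit ⨾ advance) s (StageInv e r) 19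
    at v refl eq C o = run-then (emit-run v s C o) λ s₁ (C₁ , o₁) →
      let s₂ , t , ex , t≤ , C₂ , o₂ = advance-run v s₁ C₁ o₁
      in s₂ , t , ex , t≤ , suc (toℕ v) , eq , C₂ , o₂

  SweepInv : ℕ → State → Set
  SweepInv d s = reg s rN ≡ n × reg s rD ≡ d × reg s rOne ≡ 1 × OutputIn (λ _ → d) (d * n) s

  stage-run : ∀ d s → SweepInv (suc d) s → Runs stage s (SweepInv d) (6 + n * 20)
  stage-run d s (n≡ , d≡ , one≡ , o) = run-weaken (≤-reflexive (cong (5 +_) (+-comm (n * 20) 1)))
    (assign-then (assign-then (assign-then (assign-then (run-then
      (run-while (StageInv d) (λ (_ , _ , C , _) → Counters.rem≡ C) (step-run d) n _
        -- `front d 0` is constantly `suc d`, so the bound left by the previous stage carries over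
        -- by computation, as does the room `suc d * n`.
        (0 , refl , record
          { n≡   = n≡
          ; d≡   = d≡
          ; x≡   = refl
          ; I≡   = sym (holes-zero I)
          ; J≡   = sym (holes-zero J)
          ; one≡ = one≡
          ; rem≡ = n≡
          } , o))
      λ s′ (x , x+0≡n , C , o′) → run-assign
        ( Counters.n≡ C
        , cong₂ _∸_ (Counters.d≡ C) (Counters.one≡ C)
        , Counters.one≡ C
        , Output-map end-stage ≤-refl
            (subst (λ x → OutputIn (front d x) (d * n) s′) (trans (sym (+-identityʳ x)) x+0≡n) o′)))))))

  -- The machine has no multiplication, so the start address is built by repeated addition;
  -- `i * (n + n)` is the part still to come.
  SetupInv : ℕ → State → Set
  SetupInv i s = reg s rRem ≡ i × reg s rN ≡ n × reg s rOne ≡ 1 × reg s rLen ≡ 0 × reg s rHi ≡ n + n ×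
                 reg s rLo + i * (n + n) ≡ n + n + n * (n + n) × mem s ≡ bits (I ++ J)

  setup-run : Runs setup (input I J) (SetupInv 0) (7 + n * 3)
  setup-run = assign-then (assign-then (assign-then (assign-then (assign-then (assign-then
    (run-while SetupInv proj₁
      (λ { i s (rem≡ , n≡ , one≡ , len≡ , hi≡ , lo≡ , mem≡) → assign-then (run-assign
        ( cong₂ _∸_ rem≡ one≡ , n≡ , one≡ , len≡ , hi≡
        , trans (cong (λ h → reg s rLo + h + i * (n + n)) hi≡) (trans (+-assoc (reg s rLo) _ _) lo≡)
        , mem≡)) })
      n _ (refl , refl , refl , refl , refl , refl , refl)))))))

  shortestTS-run : Runs shortestTS (input I J)
    (λ s → ∃ λ ms → Walk (suc k) I J ms × length ms ≡ dist I J ×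
           Stored (mem s) (reg s rLo) ms × reg s rLen ≡ length ms) (time n)
  shortestTS-run = run-then setup-run λ { s (_ , n≡ , one≡ , len≡ , _ , lo≡ , mem≡) →
    assign-then (assign-then
      (let s′ , t , ex , t≤ , (_ , _ , _ , o) = run-while SweepInv (proj₁ ∘ proj₂) stage-run n _
             (n≡ , n≡ , one≡ , initial s (trans (sym (+-identityʳ _)) lo≡) len≡ mem≡)
           walk , length≡ = end-sweep (Output.partial o)
       in s′ , t , ex , t≤ , Output.moves o , walk , length≡ , Output.stored o , Output.len≡ o)) }
    where
    initial : ∀ s → reg s rLo ≡ n + n + n * (n + n) → reg s rLen ≡ 0 → mem s ≡ bits (I ++ J) →
              Output (λ _ → n) (n * n) (reg s rLo) (reg s rLo) (reg s rLen) (mem s)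
    initial s lo≡ len≡ mem≡ = record
      { moves   = []
      ; partial = begin-sweep
      ; stored  = _
      ; hi≡     = refl
      ; len≡    = len≡
      ; room≤   = ≤-reflexive (trans (cong (n + n +_) (sym (*-distribˡ-+ n n n))) (sym lo≡))
      ; cellsI  = λ v → trans (cong (λ m → m (toℕ v)) mem≡) (bits-++ˡ I J v)
      ; cellsJ  = λ v → trans (cong (λ m → m (n + toℕ v)) mem≡) (trans (bits-++ʳ I J (toℕ v)) (bits-lookup J v))
      }

theorem7 : (k : ℕ) → 2 ≤ k →
    (∀ n (I J : Subset n) →
    IsPathVertexCover (path n) k I → IsPathVertexCover (path n) k J →
    Reconfigurable (path n) k I J ⇔ ∣ I ∣ ≡ ∣ J ∣)
    × (∃[ p ] ∃[ T ] (T ∈O (λ n → n ^ 2)) × ComputesShortestTS path k p T)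
theorem7 (suc k) 2≤k =
  (λ n I J cI cJ → mk⇔
    -- Slides preserve the number of holes, hence the size.
    (λ (_ , τ) → +-cancelʳ-≡ (holes J n) _ _
      (trans (cong (∣ I ∣ +_) (sym (proj₂ (TSSequence⇒dist-≤ τ)))) (trans (∣S∣+holes≡n I) (sym (∣S∣+holes≡n J)))))
    -- The run of the program carries a walk with it, which proves existence as well.
    (λ eq → let _ , _ , _ , _ , _ , walk , _ = Sweep.shortestTS-run 2≤k I J cI cJ (+-cancelˡ-≡ ∣ I ∣ _ _
                  (trans (∣S∣+holes≡n I) (trans (sym (∣S∣+holes≡n J)) (cong (_+ holes J n) (sym eq)))))
            in _ , walk⇒TSSequence walk)) ,
  shortestTS , time , time-quadratic ,
  λ n I J cI cJ (_ , τ) →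
    let s , t , ex , t≤ , ms , walk , length≡ , stored , len≡ =
          Sweep.shortestTS-run 2≤k I J cI cJ (proj₂ (TSSequence⇒dist-≤ τ))
    in s , t , length ms , walk⇒TSSequence walk , ex , t≤ ,
       -- The walk has exactly `dist I J` moves, a lower bound for every sequence.
       (λ τ′ → ≤-trans (≤-reflexive length≡) (proj₁ (TSSequence⇒dist-≤ τ′))) ,
       record
         { out-length = len≡
         ; out-from   = proj₁ ∘ Stored-lookup _ ms stored
         ; out-to     = proj₂ ∘ Stored-lookup _ ms stored
         }
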